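{- Let $\mathbf e$ be an infinite timed stream, and let $(\psi_j)$ be a finite or infinite sequence of specification versions in $\Psi$ with activation indices $0=n_0<n_1<n_2<\cdots$. Let an obligation originate at index $k$ under $\psi_j$, i.e. $n_j\le k<n_{j+1}$. Under origin-version semantics, its trigger status (whether $\mathbf e,k\models\operatorname{trig}(\psi_j)$), its outcome $X_k^{\psi_j}$, and its completion index $$c_{\psi_j}(k):=\min\{m\ge k:\ t_m>t_k+H(\psi_j)\}$$ depend only on $(\mathbf e,k,\psi_j)$ and are unaffected by subsequent revisions: any two activation histories over the same stream $\mathbf e$ that assign the same version to the origin $k$ give the same trigger status, outcome and completion index for the obligation originating at $k$. Moreover, for every origin index $k\in\mathbb N$, there exists exactly one $j$ such that $n_j\le k<n_{j+1}$. Consequently, the obligation originating at $k$ is assigned to $\psi_j$, independently of when it completes.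
   Context: Timed streams. Let $\mathcal{AP}$ be a finite set of atomic propositions. An infinite timed stream is a sequence $\mathbf e=e_0e_1e_2\cdots$ with $e_n=(t_n,\nu_n)$, $t_n\in\mathbb R_{\ge0}$, $\nu_n\subseteq\mathcal{AP}$, $t_n\le t_{n+1}$ for all $n$, and $\lim_{n\to\infty}t_n=\infty$ (non-Zeno). Formulas. $\Phi$ is the set of formulas generated by $\varphi::=p\mid\top\mid\bot\mid\neg\varphi\mid\varphi\land\varphi\mid\varphi\lor\varphi\mid\Box_{[a,b]}\varphi\mid\Diamond_{[a,b]}\varphi$ with $p\in\mathcal{AP}$, $0\le a\le b<\infty$. Satisfaction: $\mathbf e,n\models p$ iff $p\in\nu_n$; $\top$ always holds, $\bot$ never; Boolean connectives as usual; $\mathbf e,n\models\Box_{[a,b]}\varphi$ iff for all $m\ge n$ with $t_m-t_n\in[a,b]$, $\mathbf e,m\models\varphi$; $\mathbf e,n\models\Diamond_{[a,b]}\varphi$ iff there is $m\ge n$ with $t_m-t_n\in[a,b]$ and $\mathbf e,m\models\varphi$. Structural horizon: $\operatorname{hzn}(p)=\operatorname{hzn}(\top)=\operatorname{hzn}(\bot)=0$, $\operatorname{hzn}(\neg\varphi)=\operatorname{hzn}(\varphi)$, $\operatorname{hzn}(\varphi_1\circ\varphi_2)=\max\{\operatorname{hzn}(\varphi_1),\operatorname{hzn}(\varphi_2)\}$ for $\circ\in\{\land,\lor\}$, $\operatorname{hzn}(\Box_{[a,b]}\varphi)=\operatorname{hzn}(\Diamond_{[a,b]}\varphi)=b+\operatorname{hzn}(\varphi)$.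 Specifications. A parameter envelope $\mathcal A_{\mathrm{par}}\subseteq\{(\lambda,a,b)\in[0,1]\times\mathbb R_{\ge0}^2: 0\le a\le b<\infty\}$ is fixed. A specification is a tuple $\psi=(\varphi_1^{\mathrm{core}},\varphi_1^{\mathrm{adapt}},\varphi_2^{\mathrm{core}},\varphi_2^{\mathrm{adapt}},\lambda,a,b)$ with the four formulas in $\Phi$ and $(\lambda,a,b)\in\mathcal A_{\mathrm{par}}$; $\Psi$ is the set of such tuples. $\operatorname{trig}(\psi)=\varphi_1^{\mathrm{core}}\lor\varphi_1^{\mathrm{adapt}}$, $\operatorname{resp}(\psi)=\varphi_2^{\mathrm{core}}\land\varphi_2^{\mathrm{adapt}}$. Observation horizon: $H(\psi)=\max\{\operatorname{hzn}(\operatorname{trig}(\psi)),\ b+\operatorname{hzn}(\operatorname{resp}(\psi))\}$. Outcome. For a specification $\psi_j$ with response window $[a_j,b_j]$, $X_k^{\psi_j}=\mathbf 1[\exists m\ge k:\ t_m-t_k\in[a_j,b_j]\ \land\ \mathbf e,m\models\operatorname{resp}(\psi_j)]$. An obligation for $\psi_j$ is generated at $k$ if $\mathbf e,k\models\operatorname{trig}(\psi_j)$; it is completed at the first event index whose timestamp exceeds $t_k+H(\psi_j)$. Activation history and origin-version semantics. An activation history consists of a finite or infinite sequence of versions $\psi_0,\psi_1,\ldots$ and strictly increasing activation indices $0=n_0<n_1<\cdots$ in $\mathbb N$; if the sequence is finite with last version $\psi_j$, then $n_{j+1}:=\infty$. Version $\psi_j$ is active at event indices $n$ with $n_j\le n<n_{j+1}$.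 Origin-version semantics: the obligation with origin index $k$ is assigned the version $\psi_j$ with $n_j\le k<n_{j+1}$, and its trigger, response, interval and completion are evaluated with that $\psi_j$, even if later versions become active before it completes. -}

module Defs where

open import Axiom.ExcludedMiddle using (ExcludedMiddle)
open import Data.Bool using (if_then_else_)
open import Data.Fin using (Fin; toℕ)
open import Data.Fin.Subset using (Subset; _∈_)
open import Data.Nat as ℕ using (ℕ; suc)
import Data.Nat.Properties as ℕ
open import Data.Product using (∃; _×_; _,_)
open import Data.Rational as ℚ using (ℚ; 0ℚ; 1ℚ; ½)
import Data.Rational.Properties as ℚ
open import Data.Rational.Solver using (module +-*-Solver)
open import Data.Sum using (_⊎_)
open import Data.Unit using (⊤)
open import Data.Empty using (⊥)
open import Function using (id)
open import Level using (0ℓ)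
open import Relation.Binary.PropositionalEquality using (_≡_; refl; subst; subst₂)
open import Relation.Nullary using (¬_)
open import Relation.Nullary.Decidable using (does)

-- Real numbers: Cauchy sequences of rationals, compared by the setoid
-- equality _≈_.

-- ∣ x m - x n ∣ ≤ ε is expressed by the single inequality below because m
-- and n can be exchanged.
IsCauchy : (ℕ → ℚ) → Set
IsCauchy x = ∀ ε → 0ℚ ℚ.< ε →
  ∃ λ N → ∀ m n → N ℕ.≤ m → N ℕ.≤ n → x m ℚ.≤ x n ℚ.+ ε

record ℝ : Set where
  constructor mkℝ
  field
    seq    : ℕ → ℚ
    cauchy : IsCauchy seq

open ℝ public

infix  4 _<_ _≤_ _≈_ _∈[_⋯_] _≈ᶠ_ _≈ˢ_ _at_⊨_
infixl 6 _+_ _-_ _⊔_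

_<_ : ℝ → ℝ → Set
x < y = ∃ λ ε → 0ℚ ℚ.< ε ×
  (∃ λ N → ∀ n → N ℕ.≤ n → seq x n ℚ.+ ε ℚ.≤ seq y n)

_≤_ : ℝ → ℝ → Set
x ≤ y = ∀ ε → 0ℚ ℚ.< ε →
  ∃ λ N → ∀ n → N ℕ.≤ n → seq x n ℚ.≤ seq y n ℚ.+ ε

_≈_ : ℝ → ℝ → Set
x ≈ y = x ≤ y × y ≤ x

0<½* : ∀ {ε} → 0ℚ ℚ.< ε → 0ℚ ℚ.< ½ ℚ.* ε
0<½* {ε} 0<ε =
  subst (ℚ._< ½ ℚ.* ε) (ℚ.*-zeroʳ ½) (ℚ.*-monoʳ-<-pos ½ 0<ε)

fromℚ : ℚ → ℝ
fromℚ q = mkℝ (λ _ → q) λ ε 0<ε → 0 , λ _ _ _ _ →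
  subst (ℚ._≤ q ℚ.+ ε) (ℚ.+-identityʳ q) (ℚ.+-monoʳ-≤ q (ℚ.<⇒≤ 0<ε))

0ᴿ 1ᴿ : ℝ
0ᴿ = fromℚ 0ℚ
1ᴿ = fromℚ 1ℚ

_+_ : ℝ → ℝ → ℝ
x + y = mkℝ (λ n → seq x n ℚ.+ seq y n) λ ε 0<ε →
  let (M , p) = cauchy x (½ ℚ.* ε) (0<½* 0<ε)
      (N , q) = cauchy y (½ ℚ.* ε) (0<½* 0<ε)
  in M ℕ.⊔ N , λ m n hm hn →
    subst (seq x m ℚ.+ seq y m ℚ.≤_)
      (rearrange (seq x n) (seq y n) ε)
      (ℚ.+-mono-≤
        (p m n (ℕ.m⊔n≤o⇒m≤o M N hm) (ℕ.m⊔n≤o⇒m≤o M N hn))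
        (q m n (ℕ.m⊔n≤o⇒n≤o M N hm) (ℕ.m⊔n≤o⇒n≤o M N hn)))
  where
  rearrange : ∀ a b ε →
    (a ℚ.+ ½ ℚ.* ε) ℚ.+ (b ℚ.+ ½ ℚ.* ε) ≡ (a ℚ.+ b) ℚ.+ ε
  rearrange = solve 3 (λ a b ε →
    (a :+ con ½ :* ε) :+ (b :+ con ½ :* ε) := (a :+ b) :+ ε) refl
    where open +-*-Solver

-_ : ℝ → ℝ
- x = mkℝ (λ n → ℚ.- seq x n) λ ε 0<ε →
  let (N , p) = cauchy x ε 0<ε
  in N , λ m n hm hn →
    subst₂ ℚ._≤_ (left (seq x m) (seq x n)) (right (seq x m) (seq x n) ε)
      (ℚ.+-monoʳ-≤ (ℚ.- seq x m ℚ.+ ℚ.- seq x n) (p n m hn hm))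
  where
  open +-*-Solver
  left : ∀ a b → (ℚ.- a ℚ.+ ℚ.- b) ℚ.+ b ≡ ℚ.- a
  left = solve 2 (λ a b → (:- a :+ :- b) :+ b := :- a) refl
  right : ∀ a b ε → (ℚ.- a ℚ.+ ℚ.- b) ℚ.+ (a ℚ.+ ε) ≡ ℚ.- b ℚ.+ ε
  right = solve 3 (λ a b ε →
    (:- a :+ :- b) :+ (a :+ ε) := :- b :+ ε) refl

_-_ : ℝ → ℝ → ℝ
x - y = x + (- y)

_⊔_ : ℝ → ℝ → ℝ
x ⊔ y = mkℝ (λ n → seq x n ℚ.⊔ seq y n) λ ε 0<ε →
  let (M , p) = cauchy x ε 0<ε
      (N , q) = cauchy y ε 0<ε
  in M ℕ.⊔ N , λ m n hm hn →
    ℚ.⊔-lub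
      (ℚ.≤-trans
        (p m n (ℕ.m⊔n≤o⇒m≤o M N hm) (ℕ.m⊔n≤o⇒m≤o M N hn))
        (ℚ.+-monoˡ-≤ ε (ℚ.p≤p⊔q (seq x n) (seq y n))))
      (ℚ.≤-trans
        (q m n (ℕ.m⊔n≤o⇒n≤o M N hm) (ℕ.m⊔n≤o⇒n≤o M N hn))
        (ℚ.+-monoˡ-≤ ε (ℚ.p≤q⊔p (seq x n) (seq y n))))

_∈[_⋯_] : ℝ → ℝ → ℝ → Set
x ∈[ a ⋯ b ] = a ≤ x × x ≤ b

record TimedStream (p : ℕ) : Set where
  field
    time        : ℕ → ℝ
    valuation   : ℕ → Subset p
    nonNegative : ∀ n → 0ᴿ ≤ time n
    monotone    : ∀ n → time n ≤ time (suc n)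
    nonZeno     : ∀ B → ∃ λ N → ∀ n → N ℕ.≤ n → B < time n

open TimedStream public

record Interval : Set where
  field
    lower upper : ℝ
    0≤lower     : 0ᴿ ≤ lower
    lower≤upper : lower ≤ upper

open Interval public

data Formula (p : ℕ) : Set where
  atom     : Fin p → Formula p
  tt ff    : Formula p
  neg      : Formula p → Formula p
  _∧_ _∨_  : Formula p → Formula p → Formula p
  □ ◇      : Interval → Formula p → Formula p

_at_⊨_ : ∀ {p} → TimedStream p → ℕ → Formula p → Set
e at n ⊨ atom x  = x ∈ valuation e n
e at n ⊨ tt      = ⊤
e at n ⊨ ff      = ⊥
e at n ⊨ neg φ   = ¬ (e at n ⊨ φ)
e at n ⊨ (φ ∧ χ) = (e at n ⊨ φ) × (e at n ⊨ χ)
e at n ⊨ (φ ∨ χ) = (e at n ⊨ φ) ⊎ (e at n ⊨ χ)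
e at n ⊨ □ I φ   = ∀ m → n ℕ.≤ m →
  (time e m - time e n) ∈[ lower I ⋯ upper I ] → e at m ⊨ φ
e at n ⊨ ◇ I φ   = ∃ λ m → n ℕ.≤ m ×
  (time e m - time e n) ∈[ lower I ⋯ upper I ] × (e at m ⊨ φ)

hzn : ∀ {p} → Formula p → ℝ
hzn (atom _) = 0ᴿ
hzn tt       = 0ᴿ
hzn ff       = 0ᴿ
hzn (neg φ)  = hzn φ
hzn (φ ∧ χ)  = hzn φ ⊔ hzn χ
hzn (φ ∨ χ)  = hzn φ ⊔ hzn χ
hzn (□ I φ)  = upper I + hzn φ
hzn (◇ I φ)  = upper I + hzn φ

-- Equality of formulas: identical syntax trees, with interval endpoints
-- compared as real numbers rather than as Cauchy sequences.
data _≈ᶠ_ {p : ℕ} : Formula p → Formula p → Set where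
  atom : ∀ x → atom x ≈ᶠ atom x
  tt   : tt ≈ᶠ tt
  ff   : ff ≈ᶠ ff
  neg  : ∀ {φ φ′} → φ ≈ᶠ φ′ → neg φ ≈ᶠ neg φ′
  _∧_  : ∀ {φ φ′ χ χ′} → φ ≈ᶠ φ′ → χ ≈ᶠ χ′ → (φ ∧ χ) ≈ᶠ (φ′ ∧ χ′)
  _∨_  : ∀ {φ φ′ χ χ′} → φ ≈ᶠ φ′ → χ ≈ᶠ χ′ → (φ ∨ χ) ≈ᶠ (φ′ ∨ χ′)
  □    : ∀ {I J φ φ′} → lower I ≈ lower J → upper I ≈ upper J →
         φ ≈ᶠ φ′ → □ I φ ≈ᶠ □ J φ′
  ◇    : ∀ {I J φ φ′} → lower I ≈ lower J → upper I ≈ upper J →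
         φ ≈ᶠ φ′ → ◇ I φ ≈ᶠ ◇ J φ′

-- A subset of {(l , a , b) ∈ [0,1] × ℝ≥0² : a ≤ b}; being a set of reals,
-- it respects _≈_.
record ParameterEnvelope : Set₁ where
  field
    Contains : ℝ → ℝ → ℝ → Set
    respects : ∀ {l l′ a a′ b b′} → l ≈ l′ → a ≈ a′ → b ≈ b′ →
               Contains l a b → Contains l′ a′ b′
    bounds   : ∀ {l a b} → Contains l a b →
               l ∈[ 0ᴿ ⋯ 1ᴿ ] × 0ᴿ ≤ a × a ≤ b

open ParameterEnvelope public

record Specification (p : ℕ) (A : ParameterEnvelope) : Set where
  field
    φ₁-core φ₁-adapt φ₂-core φ₂-adapt : Formula p
    weight start end : ℝ
    admissible       : Contains A weight start end

open Specification public

record _≈ˢ_ {p A} (ψ ψ′ : Specification p A) : Set where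
  field
    φ₁-core≈  : φ₁-core ψ ≈ᶠ φ₁-core ψ′
    φ₁-adapt≈ : φ₁-adapt ψ ≈ᶠ φ₁-adapt ψ′
    φ₂-core≈  : φ₂-core ψ ≈ᶠ φ₂-core ψ′
    φ₂-adapt≈ : φ₂-adapt ψ ≈ᶠ φ₂-adapt ψ′
    weight≈   : weight ψ ≈ weight ψ′
    start≈    : start ψ ≈ start ψ′
    end≈      : end ψ ≈ end ψ′

module _ {p : ℕ} {A : ParameterEnvelope} where

  trig resp : Specification p A → Formula p
  trig ψ = φ₁-core ψ ∨ φ₁-adapt ψ
  resp ψ = φ₂-core ψ ∧ φ₂-adapt ψ

  H : Specification p A → ℝ
  H ψ = hzn (trig ψ) ⊔ (end ψ + hzn (resp ψ))

  Responds : TimedStream p → Specification p A → ℕ → Set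
  Responds e ψ k = ∃ λ m → k ℕ.≤ m ×
    (time e m - time e k) ∈[ start ψ ⋯ end ψ ] × (e at m ⊨ resp ψ)

  -- The indicator of an arbitrary proposition is a number only classically.
  X : ExcludedMiddle 0ℓ → TimedStream p → Specification p A → ℕ → ℕ
  X em e ψ k = if does (em {Responds e ψ k}) then 1 else 0

  -- c = min { m ≥ k : t_m > t_k + H(ψ) }
  IsCompletionIndex : TimedStream p → Specification p A → ℕ → ℕ → Set
  IsCompletionIndex e ψ k c = Late c × (∀ m → Late m → c ℕ.≤ m)
    where
    Late : ℕ → Set
    Late m = k ℕ.≤ m × time e k + H ψ < time e m

data Extent : Set where
  finite   : (last : ℕ) → Extent
  infinite : Extent

Index : Extent → Set
Index (finite last) = Fin (suc last)
Index infinite      = ℕ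

position : ∀ {E} → Index E → ℕ
position {finite _} = toℕ
position {infinite} = id

record History (p : ℕ) (A : ParameterEnvelope) : Set where
  field
    extent     : Extent
    version    : Index extent → Specification p A
    activation : Index extent → ℕ
    initial    : ∀ i → position i ≡ 0 → activation i ≡ 0
    increasing : ∀ i j → position i ℕ.< position j →
                 activation i ℕ.< activation j

open History public

module _ {p : ℕ} {A : ParameterEnvelope} (h : History p A) where

  -- n_j ≤ k < n_{j+1}.  When j is the last index, no i satisfies the premise
  -- of the upper bound, which amounts to n_{j+1} = ∞.
  ActiveAt : ℕ → Index (extent h) → Set
  ActiveAt k j = activation h j ℕ.≤ k ×
    (∀ i → position i ≡ suc (position j) → k ℕ.< activation h i)

  -- Origin-version semantics of the obligation with origin k: it is assigned
  -- the version active at k, and that version evaluates it.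

  Assigned : ℕ → Specification p A → Set
  Assigned k ψ = ∃ λ j → ActiveAt k j × version h j ≈ˢ ψ

  Triggered : TimedStream p → ℕ → Set
  Triggered e k = ∃ λ j → ActiveAt k j × (e at k ⊨ trig (version h j))

  HasOutcome : ExcludedMiddle 0ℓ → TimedStream p → ℕ → ℕ → Set
  HasOutcome em e k x = ∃ λ j → ActiveAt k j × x ≡ X em e (version h j) k

  CompletesAt : TimedStream p → ℕ → ℕ → Set
  CompletesAt e k c = ∃ λ j →
    ActiveAt k j × IsCompletionIndex e (version h j) k c

{-# OPTIONS --safe #-}
module Submission where

-- The increasing activation indices cut ℕ into disjoint half-open blocks, so
-- an origin determines its version and every evaluation under a history is
-- the evaluation under that one version.  Versions need only agree up to
-- equality of real parameters, hence satisfaction, horizons and completion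
-- indices are shown to respect _≈_.

open import Defs
open import Axiom.ExcludedMiddle using (ExcludedMiddle)
open import Data.Bool using (if_then_else_)
open import Data.Fin using (fromℕ<; zero)
open import Data.Fin.Properties using (toℕ<n; toℕ-fromℕ<; toℕ-injective)
open import Data.Nat as ℕ using (ℕ; suc)
open import Data.Nat.Induction using (<-rec)
import Data.Nat.Properties as ℕ
open import Data.Product using (∃; ∃!; _×_; _,_; proj₁; proj₂)
open import Data.Product.Function.NonDependent.Propositional using (_×-⇔_)
open import Data.Rational as ℚ using (½)
import Data.Rational.Properties as ℚ
open import Data.Rational.Solver using (module +-*-Solver)
open import Data.Sum using (inj₁; inj₂)
open import Data.Sum.Function.Propositional using (_⊎-⇔_)
open import Function using (id)
open import Function.Bundles using (_⇔_; mk⇔; Equivalence)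
open import Function.Properties.Equivalence using ()
  renaming (refl to ⇔-refl; sym to ⇔-sym; trans to ⇔-trans)
open import Function.Related.TypeIsomorphisms using (¬-cong-⇔; →-cong-⇔)
open import Level using (0ℓ)
open import Relation.Binary.Definitions using (tri<; tri≈; tri>)
open import Relation.Binary.PropositionalEquality
  using (_≡_; refl; sym; trans; cong; subst)
open import Relation.Nullary using (¬_; yes; no; contradiction)
open import Relation.Nullary.Decidable using (does-⇔)

-- Order, sum and maximum of Cauchy reals

halves : ∀ q ε → (q ℚ.+ ½ ℚ.* ε) ℚ.+ ½ ℚ.* ε ≡ q ℚ.+ ε
halves = solve 2 (λ q ε → (q :+ con ½ :* ε) :+ con ½ :* ε := q :+ ε) refl
  where open +-*-Solver

+-halves : ∀ q r ε →
  (q ℚ.+ ½ ℚ.* ε) ℚ.+ (r ℚ.+ ½ ℚ.* ε) ≡ (q ℚ.+ r) ℚ.+ ε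
+-halves = solve 3 (λ q r ε →
  (q :+ con ½ :* ε) :+ (r :+ con ½ :* ε) := (q :+ r) :+ ε) refl
  where open +-*-Solver

≤-trans : ∀ {x y z} → x ≤ y → y ≤ z → x ≤ z
≤-trans {x} {y} {z} x≤y y≤z ε 0<ε =
  let (M , p) = x≤y (½ ℚ.* ε) (0<½* 0<ε)
      (N , q) = y≤z (½ ℚ.* ε) (0<½* 0<ε)
  in M ℕ.⊔ N , λ n M⊔N≤n →
    subst (seq x n ℚ.≤_) (halves (seq z n) ε)
      (ℚ.≤-trans (p n (ℕ.m⊔n≤o⇒m≤o M N M⊔N≤n))
        (ℚ.+-monoˡ-≤ (½ ℚ.* ε) (q n (ℕ.m⊔n≤o⇒n≤o M N M⊔N≤n))))

≤-refl : ∀ {x} → x ≤ x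
≤-refl {x} ε 0<ε = 0 , λ n _ →
  subst (ℚ._≤ seq x n ℚ.+ ε) (ℚ.+-identityʳ (seq x n))
    (ℚ.+-monoʳ-≤ (seq x n) (ℚ.<⇒≤ 0<ε))

-- Half of the gap `ε` between `y` and `z` absorbs the slack in `x ≤ y`; the other half remains as a
-- gap between `x` and `z`.
≤-<-trans : ∀ {x y z} → x ≤ y → y < z → x < z
≤-<-trans {x} {y} {z} x≤y (ε , 0<ε , N , q) =
  let (M , p) = x≤y (½ ℚ.* ε) (0<½* 0<ε)
  in ½ ℚ.* ε , 0<½* 0<ε , M ℕ.⊔ N , λ n M⊔N≤n →
    ℚ.≤-trans
      (subst (seq x n ℚ.+ ½ ℚ.* ε ℚ.≤_) (halves (seq y n) ε)
        (ℚ.+-monoˡ-≤ (½ ℚ.* ε) (p n (ℕ.m⊔n≤o⇒m≤o M N M⊔N≤n))))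
      (q n (ℕ.m⊔n≤o⇒n≤o M N M⊔N≤n))

+-mono-≤ : ∀ {x x′ y y′} → x ≤ x′ → y ≤ y′ → x + y ≤ x′ + y′
+-mono-≤ {x} {x′} {y} {y′} x≤x′ y≤y′ ε 0<ε =
  let (M , p) = x≤x′ (½ ℚ.* ε) (0<½* 0<ε)
      (N , q) = y≤y′ (½ ℚ.* ε) (0<½* 0<ε)
  in M ℕ.⊔ N , λ n M⊔N≤n →
    subst (seq x n ℚ.+ seq y n ℚ.≤_) (+-halves (seq x′ n) (seq y′ n) ε)
      (ℚ.+-mono-≤ (p n (ℕ.m⊔n≤o⇒m≤o M N M⊔N≤n))
        (q n (ℕ.m⊔n≤o⇒n≤o M N M⊔N≤n)))

⊔-mono-≤ : ∀ {x x′ y y′} → x ≤ x′ → y ≤ y′ → x ⊔ y ≤ x′ ⊔ y′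
⊔-mono-≤ {x} {x′} {y} {y′} x≤x′ y≤y′ ε 0<ε =
  let (M , p) = x≤x′ ε 0<ε
      (N , q) = y≤y′ ε 0<ε
  in M ℕ.⊔ N , λ n M⊔N≤n →
    ℚ.⊔-lub
      (ℚ.≤-trans (p n (ℕ.m⊔n≤o⇒m≤o M N M⊔N≤n))
        (ℚ.+-monoˡ-≤ ε (ℚ.p≤p⊔q (seq x′ n) (seq y′ n))))
      (ℚ.≤-trans (q n (ℕ.m⊔n≤o⇒n≤o M N M⊔N≤n))
        (ℚ.+-monoˡ-≤ ε (ℚ.p≤q⊔p (seq x′ n) (seq y′ n))))

≈-refl : ∀ {x} → x ≈ x
≈-refl {x} = ≤-refl {x} , ≤-refl {x}

+-cong : ∀ {x x′ y y′} → x ≈ x′ → y ≈ y′ → x + y ≈ x′ + y′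
+-cong {x} {x′} {y} {y′} (x≤x′ , x′≤x) (y≤y′ , y′≤y) =
  +-mono-≤ {x} {x′} {y} {y′} x≤x′ y≤y′ , +-mono-≤ {x′} {x} {y′} {y} x′≤x y′≤y

⊔-cong : ∀ {x x′ y y′} → x ≈ x′ → y ≈ y′ → x ⊔ y ≈ x′ ⊔ y′
⊔-cong {x} {x′} {y} {y′} (x≤x′ , x′≤x) (y≤y′ , y′≤y) =
  ⊔-mono-≤ {x} {x′} {y} {y′} x≤x′ y≤y′ , ⊔-mono-≤ {x′} {x} {y′} {y} x′≤x y′≤y

-- Replacing a version moves only the deadline, on the left of `<`; event times come from the fixed
-- stream.
<-congˡ : ∀ {x x′ y} → x ≈ x′ → (x < y) ⇔ (x′ < y)
<-congˡ {x} {x′} {y} (x≤x′ , x′≤x) =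
  mk⇔ (≤-<-trans {x′} {x} {y} x′≤x) (≤-<-trans {x} {x′} {y} x≤x′)

∈-cong : ∀ {x a a′ b b′} → a ≈ a′ → b ≈ b′ →
  x ∈[ a ⋯ b ] ⇔ x ∈[ a′ ⋯ b′ ]
∈-cong {x} {a} {a′} {b} {b′} (a≤a′ , a′≤a) (b≤b′ , b′≤b) = mk⇔
  (λ (a≤x , x≤b) → ≤-trans {a′} {a} {x} a′≤a a≤x , ≤-trans {x} {b} {b′} x≤b b≤b′)
  (λ (a′≤x , x≤b′) → ≤-trans {a} {a′} {x} a≤a′ a′≤x , ≤-trans {x} {b′} {b} x≤b′ b′≤b)

-- Invariance of evaluation under equality of real parameters

hzn-cong : ∀ {p} {φ φ′ : Formula p} → φ ≈ᶠ φ′ → hzn φ ≈ hzn φ′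
hzn-cong (atom x) = ≈-refl {0ᴿ}
hzn-cong tt       = ≈-refl {0ᴿ}
hzn-cong ff       = ≈-refl {0ᴿ}
hzn-cong (neg r)  = hzn-cong r
hzn-cong (_∧_ {φ} {φ′} {χ} {χ′} r s) =
  ⊔-cong {hzn φ} {hzn φ′} {hzn χ} {hzn χ′} (hzn-cong r) (hzn-cong s)
hzn-cong (_∨_ {φ} {φ′} {χ} {χ′} r s) =
  ⊔-cong {hzn φ} {hzn φ′} {hzn χ} {hzn χ′} (hzn-cong r) (hzn-cong s)
hzn-cong (□ {I} {J} {φ} {φ′} _ u r) =
  +-cong {upper I} {upper J} {hzn φ} {hzn φ′} u (hzn-cong r)
hzn-cong (◇ {I} {J} {φ} {φ′} _ u r) =
  +-cong {upper I} {upper J} {hzn φ} {hzn φ′} u (hzn-cong r)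

∀-cong-⇔ : ∀ {A : Set} {P Q : A → Set} →
  (∀ x → P x ⇔ Q x) → (∀ x → P x) ⇔ (∀ x → Q x)
∀-cong-⇔ P⇔Q = mk⇔
  (λ f x → Equivalence.to (P⇔Q x) (f x))
  (λ g x → Equivalence.from (P⇔Q x) (g x))

∃-cong-⇔ : ∀ {A : Set} {P Q : A → Set} →
  (∀ x → P x ⇔ Q x) → ∃ P ⇔ ∃ Q
∃-cong-⇔ P⇔Q = mk⇔
  (λ (x , px) → x , Equivalence.to (P⇔Q x) px)
  (λ (x , qx) → x , Equivalence.from (P⇔Q x) qx)

module _ {p : ℕ} (e : TimedStream p) where

  -- Interval endpoints matter only through membership of a time difference. Both directions are
  -- carried together because negation and the premise of `□` reverse implications.
  ⊨-cong : ∀ {φ φ′} → φ ≈ᶠ φ′ → ∀ n → (e at n ⊨ φ) ⇔ (e at n ⊨ φ′)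
  ⊨-cong (atom x) n = ⇔-refl
  ⊨-cong tt       n = ⇔-refl
  ⊨-cong ff       n = ⇔-refl
  ⊨-cong (neg r)  n = ¬-cong-⇔ (⊨-cong r n)
  ⊨-cong (r ∧ s)  n = ⊨-cong r n ×-⇔ ⊨-cong s n
  ⊨-cong (r ∨ s)  n = ⊨-cong r n ⊎-⇔ ⊨-cong s n
  ⊨-cong (□ {I} {J} l u r) n = ∀-cong-⇔ λ m → ∀-cong-⇔ λ _ →
    →-cong-⇔
      (∈-cong {time e m - time e n} {lower I} {lower J} {upper I} {upper J} l u)
      (⊨-cong r m)
  ⊨-cong (◇ {I} {J} l u r) n = ∃-cong-⇔ λ m → ⇔-refl ×-⇔
    (∈-cong {time e m - time e n} {lower I} {lower J} {upper I} {upper J} l u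
      ×-⇔ ⊨-cong r m)

module _ {p : ℕ} {A : ParameterEnvelope} (e : TimedStream p)
  {ψ ψ′ : Specification p A} (ψ≈ψ′ : ψ ≈ˢ ψ′) where

  open _≈ˢ_ ψ≈ψ′

  trig-cong : trig ψ ≈ᶠ trig ψ′
  trig-cong = φ₁-core≈ ∨ φ₁-adapt≈

  resp-cong : resp ψ ≈ᶠ resp ψ′
  resp-cong = φ₂-core≈ ∧ φ₂-adapt≈

  H-cong : H ψ ≈ H ψ′
  H-cong =
    ⊔-cong {hzn (trig ψ)} {hzn (trig ψ′)}
      {end ψ + hzn (resp ψ)} {end ψ′ + hzn (resp ψ′)}
      (hzn-cong trig-cong)
      (+-cong {end ψ} {end ψ′} {hzn (resp ψ)} {hzn (resp ψ′)}
        end≈ (hzn-cong resp-cong))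

  Responds-cong : ∀ k → Responds e ψ k ⇔ Responds e ψ′ k
  Responds-cong k = ∃-cong-⇔ λ m → ⇔-refl ×-⇔
    (∈-cong {time e m - time e k} {start ψ} {start ψ′} {end ψ} {end ψ′}
      start≈ end≈
      ×-⇔ ⊨-cong e resp-cong m)

  -- The two indicators come from separate decisions by `em`, but decisions of equivalent
  -- propositions have the same truth value.
  X-cong : (em : ExcludedMiddle 0ℓ) → ∀ k → X em e ψ k ≡ X em e ψ′ k
  X-cong em k =
    cong (if_then 1 else 0) (does-⇔ (Responds-cong k) em em)

  -- The horizon enters only through lateness, which has the same extension for both versions; hence
  -- so does being its least element.
  IsCompletionIndex-cong : ∀ k c →
    IsCompletionIndex e ψ k c ⇔ IsCompletionIndex e ψ′ k c
  IsCompletionIndex-cong k c =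
    late c ×-⇔ ∀-cong-⇔ λ m → →-cong-⇔ (late m) ⇔-refl
    where
    late : ∀ m → (k ℕ.≤ m × time e k + H ψ < time e m)
               ⇔ (k ℕ.≤ m × time e k + H ψ′ < time e m)
    late m = ⇔-refl ×-⇔
      <-congˡ {time e k + H ψ} {time e k + H ψ′} {time e m}
        (+-cong {time e k} {time e k} {H ψ} {H ψ′} (≈-refl {time e k}) H-cong)

-- Existence and uniqueness of the completion index

∃!-least : ExcludedMiddle 0ℓ → (P : ℕ → Set) → ∃ P →
  ∃! _≡_ (λ c → P c × (∀ m → P m → c ℕ.≤ m))
∃!-least em P (n , Pn) =
  let (c , Pc , c≤) = <-rec Goal step n Pn
  in c , (Pc , c≤) , λ (Pd , d≤) → ℕ.≤-antisym (c≤ _ Pd) (d≤ c Pc)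
  where
  Goal : ℕ → Set
  Goal n = P n → ∃ λ c → P c × (∀ m → P m → c ℕ.≤ m)

  step : ∀ n → (∀ {m} → m ℕ.< n → Goal m) → Goal n
  -- `P` may be undecidable, as strict order of reals is, so `em` settles whether a smaller witness
  -- exists; if none does, `n` is least.
  step n rec Pn with em {∃ λ m → m ℕ.< n × P m}
  ... | yes (m , m<n , Pm) = rec m<n Pm
  ... | no none = n , Pn , λ m Pm → ℕ.≮⇒≥ λ m<n → none (m , m<n , Pm)

completion-∃! : ExcludedMiddle 0ℓ →
  ∀ {p A} (e : TimedStream p) (ψ : Specification p A) k →
  ∃! _≡_ (IsCompletionIndex e ψ k)
completion-∃! em e ψ k =
  let (N , late) = nonZeno e (time e k + H ψ)
  in ∃!-least em (λ m → k ℕ.≤ m × time e k + H ψ < time e m)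
       (k ℕ.⊔ N , ℕ.m≤m⊔n k N , late (k ℕ.⊔ N) (ℕ.m≤n⊔m k N))

-- Positions in finite and infinite histories

position-injective : ∀ E {i j : Index E} →
  position {E} i ≡ position {E} j → i ≡ j
position-injective (finite _) = toℕ-injective
position-injective infinite   = id

-- Positions are closed downwards, which supplies a successor to any index lying before another one.
index≤ : ∀ E {n} (j : Index E) → n ℕ.≤ position {E} j →
  ∃ λ (i : Index E) → position {E} i ≡ n
index≤ (finite _) j n≤j = fromℕ< n<1+last , toℕ-fromℕ< n<1+last
  where n<1+last = ℕ.≤-<-trans n≤j (toℕ<n j)
index≤ infinite {n} j _ = n , refl

first : ∀ E → ∃ λ (i : Index E) → position {E} i ≡ 0
first (finite _) = zero , refl
first infinite   = 0 , refl

-- The version active at an origin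

module _ {p : ℕ} {A : ParameterEnvelope} (h : History p A) where

  private
    E   = extent h
    pos = position {E}
    act = activation h

  activation-mono-≤ : ∀ i j → pos i ℕ.≤ pos j → act i ℕ.≤ act j
  activation-mono-≤ i j i≤j with ℕ.m≤n⇒m<n∨m≡n i≤j
  ... | inj₁ i<j = ℕ.<⇒≤ (increasing h i j i<j)
  ... | inj₂ i≡j = ℕ.≤-reflexive (cong act (position-injective E i≡j))

  -- The successor `i⁺` of `i` would be activated no later than `j`, hence by `k`, whereas activity
  -- of `i` at `k` puts that activation after `k`.
  active-≮ : ∀ {k i j} → ActiveAt h k i → ActiveAt h k j → ¬ (pos i ℕ.< pos j)
  active-≮ {k} {i} {j} (_ , k<next) (actj≤k , _) i<j =
    let (i⁺ , i⁺≡) = index≤ E j i<j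
    in ℕ.<⇒≱ (k<next i⁺ i⁺≡)
         (ℕ.≤-trans
           (activation-mono-≤ i⁺ j (subst (ℕ._≤ pos j) (sym i⁺≡) i<j)) actj≤k)

  active-unique : ∀ {k i j} → ActiveAt h k i → ActiveAt h k j → i ≡ j
  active-unique {k} {i} {j} ai aj with ℕ.<-cmp (pos i) (pos j)
  ... | tri< i<j _ _ = contradiction i<j (active-≮ ai aj)
  ... | tri≈ _ i≡j _ = position-injective E i≡j
  ... | tri> _ _ j<i = contradiction j<i (active-≮ aj ai)

  -- Walking up the activation indices strictly decreases k ∸ act i, so the
  -- walk stops, even in an infinite history.
  active-∃! : ExcludedMiddle 0ℓ → ∀ k → ∃! _≡_ (ActiveAt h k)
  active-∃! em k =
    let (i₀ , i₀≡0) = first E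
        (j , aj)    = <-rec Goal step (k ℕ.∸ act i₀) i₀ refl
                        -- The walk can start at the first version for every `k`, since its
                        -- activation index is 0.
                        (subst (ℕ._≤ k) (sym (initial h i₀ i₀≡0)) ℕ.z≤n)
    in j , aj , active-unique aj
    where
    Goal : ℕ → Set
    Goal d = ∀ i → k ℕ.∸ act i ≡ d → act i ℕ.≤ k → ∃ (ActiveAt h k)

    step : ∀ d → (∀ {d′} → d′ ℕ.< d → Goal d′) → Goal d
    step _ rec i refl acti≤k
      with em {∃ λ i⁺ → pos i⁺ ≡ suc (pos i) × act i⁺ ℕ.≤ k}
    ... | yes (i⁺ , i⁺≡ , acti⁺≤k) =
      rec (ℕ.∸-monoʳ-< (increasing h i i⁺ (ℕ.≤-reflexive (sym i⁺≡))) acti⁺≤k)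
        i⁺ refl acti⁺≤k
    -- This case includes the last version of a finite history, where no `i⁺` exists and the upper
    -- bound holds vacuously.
    ... | no none =
      i , acti≤k , λ i⁺ i⁺≡ → ℕ.≰⇒> λ acti⁺≤k → none (i⁺ , i⁺≡ , acti⁺≤k)

  -- By uniqueness the existential can only be witnessed by `j`. All notions of origin-version
  -- semantics have this shape, so each reduces to the version at `j`.
  active-⇔ : ∀ {k j} (P : Index E → Set) → ActiveAt h k j →
    (∃ λ i → ActiveAt h k i × P i) ⇔ P j
  active-⇔ {k} {j} P aj = mk⇔
    (λ (i , ai , Pi) → subst P (active-unique ai aj) Pi)
    (λ Pj → j , aj , Pj)

  module _ {k : ℕ} {ψ : Specification p A} (e : TimedStream p)
    (assigned : Assigned h k ψ) where

    private
      j     = proj₁ assigned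
      aj    = proj₁ (proj₂ assigned)
      ψⱼ≈ψ = proj₂ (proj₂ assigned)

    -- First the history collapses to its active version, then that version is exchanged for `ψ`.
    -- The right-hand side no longer mentions `h`, so it can link two histories.
    triggered-⇔ : Triggered h e k ⇔ (e at k ⊨ trig ψ)
    triggered-⇔ = ⇔-trans
      (active-⇔ (λ i → e at k ⊨ trig (version h i)) aj)
      (⊨-cong e (trig-cong e ψⱼ≈ψ) k)

    outcome-⇔ : (em : ExcludedMiddle 0ℓ) → ∀ x → HasOutcome h em e k x ⇔ (x ≡ X em e ψ k)
    outcome-⇔ em x = ⇔-trans
      (active-⇔ (λ i → x ≡ X em e (version h i) k) aj)
      (mk⇔ (λ x≡ → trans x≡ Xⱼ≡X) (λ x≡ → trans x≡ (sym Xⱼ≡X)))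
      where Xⱼ≡X = X-cong e ψⱼ≈ψ em k

    completes-⇔ : ∀ c → CompletesAt h e k c ⇔ IsCompletionIndex e ψ k c
    completes-⇔ c = ⇔-trans
      (active-⇔ (λ i → IsCompletionIndex e (version h i) k c) aj)
      (IsCompletionIndex-cong e ψⱼ≈ψ k c)

theorem2 :
  (em : ExcludedMiddle 0ℓ) →
  (p : ℕ) (A : ParameterEnvelope) (e : TimedStream p) →
  -- the evaluation of the obligation is determined by e, k and ψ_j
  ((h : History p A) (k : ℕ) (j : Index (extent h)) → ActiveAt h k j →
    (Triggered h e k ⇔ (e at k ⊨ trig (version h j)))
    × (∀ x → HasOutcome h em e k x ⇔ (x ≡ X em e (version h j) k))
    × ∃! _≡_ (IsCompletionIndex e (version h j) k)
    × (∀ c → CompletesAt h e k c ⇔ IsCompletionIndex e (version h j) k c))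
  -- histories assigning the same version to k evaluate the obligation alike
  × ((h h′ : History p A) (k : ℕ) (ψ : Specification p A) →
    Assigned h k ψ → Assigned h′ k ψ →
    (Triggered h e k ⇔ Triggered h′ e k)
    × (∀ x → HasOutcome h em e k x ⇔ HasOutcome h′ em e k x)
    × (∀ c → CompletesAt h e k c ⇔ CompletesAt h′ e k c))
  -- exactly one version is active at every origin
  × ((h : History p A) (k : ℕ) → ∃! _≡_ (ActiveAt h k))
  -- the assigned version is ψ_j, whatever the completion index c
  × ((h : History p A) (k : ℕ) (j : Index (extent h)) → ActiveAt h k j →
    ∀ c → CompletesAt h e k c →
    ∀ ψ → Assigned h k ψ ⇔ (version h j ≈ˢ ψ))
theorem2 em p A e =
  (λ h k j aj →
    active-⇔ h (λ i → e at k ⊨ trig (version h i)) aj ,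
    (λ x → active-⇔ h (λ i → x ≡ X em e (version h i) k) aj) ,
    completion-∃! em e (version h j) k ,
    λ c → active-⇔ h (λ i → IsCompletionIndex e (version h i) k c) aj) ,
  -- Each history is compared with `ψ` itself, and the two equivalences are composed.
  (λ h h′ k ψ s s′ →
    ⇔-trans (triggered-⇔ h e s) (⇔-sym (triggered-⇔ h′ e s′)) ,
    (λ x → ⇔-trans (outcome-⇔ h e s em x) (⇔-sym (outcome-⇔ h′ e s′ em x))) ,
    λ c → ⇔-trans (completes-⇔ h e s c) (⇔-sym (completes-⇔ h′ e s′ c))) ,
  (λ h k → active-∃! h em k) ,
  λ h k j aj c _ ψ → active-⇔ h (λ i → version h i ≈ˢ ψ) aj
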